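{- Let $\mathcal{Q}$ be any stable set of Boolean matrices with VC dimension $d$. Then for any constant $k \ge d$, $\mathsf{D}^{\mathcal{Q}}(\mathsf{EHD}_k) = \omega(1)$; that is, $\mathsf{D}^{\mathcal{Q}}(\mathsf{EHD}_k^n) \to \infty$ as $n \to \infty$.
   Context: For an integer $k \ge 0$, $\mathsf{EHD}_k = (\mathsf{EHD}_k^n)_{n\in\mathbb{N}}$, where $\mathsf{EHD}_k^n$ is the $2^n \times 2^n$ Boolean matrix with rows and columns indexed by $\{0,1\}^n$ and $\mathsf{EHD}_k^n(x,y) = 1$ if and only if the Hamming distance of $x,y$ equals $k$. For a set $\mathcal{M}$ of Boolean matrices, the query set $\mathsf{QS}(\mathcal{M})$ is the set of all matrices obtained from matrices in $\mathcal{M}$ by the operations: arbitrary row and column permutations; taking arbitrary submatrices; duplicating arbitrary rows or columns. $\mathsf{GT}_t$ is the $t\times t$ matrix with $\mathsf{GT}_t(i,j) = 1$ if and only if $i \le j$, $i,j\in\{1,\dots,t\}$. A set $\mathcal{M}$ of matrices is stable if there is a constant $t$ such that $\mathsf{GT}_t \notin \mathsf{QS}(\mathcal{M})$. The VC dimension of a Boolean matrix $M$ is the largest $d$ such that there are $d$ columns $y^{(1)},\dots,y^{(d)}$ such that for every $S \subseteq \{1,\dots,d\}$ there is a row $x^S$ with $M(x^S,y^{(i)}) = 1$ if and only if $i \in S$. The VC dimension of a set of matrices is the maximum VC dimension of a matrix in it. For $P \in \{0,1\}^{N \times N}$, a deterministic communication protocol with oracle access to $\mathcal{M}$ is a binary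 tree in which each inner node $v$ is associated with an $N \times N$ matrix $Q_v \in \mathsf{QS}(\mathcal{M})$ (with the same row and column index sets as $P$) and each leaf $\ell$ with a bit $b_\ell \in \{0,1\}$. An input $(x,y)$ defines a root-to-leaf path: at node $v$ the entry $Q_v(x,y)$ decides whether to go left or right; the output is the bit of the leaf reached. The protocol computes $P$ if the output is $P(x,y)$ for every $(x,y)$. Its cost is the depth of the tree, and $\mathsf{D}^{\mathcal{M}}(P)$ is the minimum cost of such a protocol computing $P$ ($\infty$ if there is none). -}

module Defs where

open import Level using (Level)
open import Data.Bool using (Bool; true; if_then_else_)
open import Data.Fin using (Fin; zero; suc; finToFun; _≟_)
import Data.Fin as Fin
open import Data.Fin.Permutation using (Permutation′; _⟨$⟩ʳ_)
open import Data.Fin.Subset using (Subset; _∈_)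
open import Data.Nat as ℕ using (ℕ; _≤_; _<_; _^_)
open import Data.Product using (_×_; ∃-syntax; Σ-syntax)
open import Data.Vec using (count; allFin)
open import Function.Bundles using (_⇔_)
open import Relation.Binary.Core using (_Preserves_⟶_)
open import Relation.Binary.PropositionalEquality using (_≡_)
open import Relation.Nullary using (¬_; ¬?; does)

private
  variable
    ℓ : Level
    m m′ n n′ N : ℕ

Matrix : ℕ → ℕ → Set
Matrix m n = Fin m → Fin n → Bool

MatrixSet : (ℓ : Level) → Set (Level.suc ℓ)
MatrixSet ℓ = (m n : ℕ) → Matrix m n → Set ℓ

copy : Fin m → Fin (ℕ.suc m) → Fin m
copy i zero    = i
copy i (suc j) = j

-- Matrices are functions, so `resp` is needed to identify matrices that have
-- the same entries.  Submatrices keep the order of the selected rows and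
-- columns; a copied row or column is put in front and can then be permuted.
data QS (ℳ : MatrixSet ℓ) : {m n : ℕ} → Matrix m n → Set ℓ where
  base    : {A : Matrix m n} → ℳ m n A → QS ℳ A
  resp    : {A B : Matrix m n} → (∀ i j → A i j ≡ B i j) → QS ℳ A → QS ℳ B
  permute : {A : Matrix m n} (σ : Permutation′ m) (τ : Permutation′ n) →
            QS ℳ A → QS ℳ (λ i j → A (σ ⟨$⟩ʳ i) (τ ⟨$⟩ʳ j))
  sub     : {A : Matrix m n} (f : Fin m′ → Fin m) (g : Fin n′ → Fin n) →
            f Preserves Fin._<_ ⟶ Fin._<_ → g Preserves Fin._<_ ⟶ Fin._<_ →
            QS ℳ A → QS ℳ (λ i j → A (f i) (g j))
  dupRow  : {A : Matrix m n} (r : Fin m) → QS ℳ A → QS ℳ (λ i j → A (copy r i) j)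
  dupCol  : {A : Matrix m n} (c : Fin n) → QS ℳ A → QS ℳ (λ i j → A i (copy c j))

GT : (t : ℕ) → Matrix t t
GT t i j = does (i Fin.≤? j)

Stable : MatrixSet ℓ → Set ℓ
Stable ℳ = ∃[ t ] ¬ QS ℳ (GT t)

-- The columns y i are automatically pairwise distinct.
Shatters : Matrix m n → ℕ → Set
Shatters {m} {n} M d =
  Σ[ y ∈ (Fin d → Fin n) ] ((S : Subset d) →
    Σ[ x ∈ Fin m ] ((i : Fin d) → (M x (y i) ≡ true) ⇔ (i ∈ S)))

-- A matrix without rows shatters nothing and has no VC dimension.
HasVCDim : Matrix m n → ℕ → Set
HasVCDim M d = Shatters M d × (∀ e → Shatters M e → e ≤ d)

SetHasVCDim : MatrixSet ℓ → ℕ → Set ℓ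
SetHasVCDim ℳ d =
  (∃[ m ] ∃[ n ] Σ[ M ∈ Matrix m n ] (ℳ m n M × HasVCDim M d)) ×
  (∀ m n (M : Matrix m n) → ℳ m n M → ∀ e → HasVCDim M e → e ≤ d)

hammingDistance : (Fin n → Fin 2) → (Fin n → Fin 2) → ℕ
hammingDistance {n} x y = count (λ i → ¬? (x i ≟ y i)) (allFin n)

-- The index set {0,1}ⁿ is enumerated by the library bijection
-- finToFun : Fin (2 ^ n) → (Fin n → Fin 2).
EHD : ℕ → (n : ℕ) → Matrix (2 ^ n) (2 ^ n)
EHD k n x y =
  does (hammingDistance {n} (finToFun {2} {n} x) (finToFun {2} {n} y) ℕ.≟ k)

data Protocol (ℳ : MatrixSet ℓ) (N : ℕ) : Set ℓ where
  leaf : Bool → Protocol ℳ N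
  node : (A : Matrix N N) → QS ℳ A → Protocol ℳ N → Protocol ℳ N → Protocol ℳ N

output : {ℳ : MatrixSet ℓ} → Protocol ℳ N → Matrix N N
output (leaf b)       x y = b
output (node A _ l r) x y = if A x y then output r x y else output l x y

Computes : {ℳ : MatrixSet ℓ} → Protocol ℳ N → Matrix N N → Set
Computes π P = ∀ x y → output π x y ≡ P x y

cost : {ℳ : MatrixSet ℓ} → Protocol ℳ N → ℕ
cost (leaf _)       = 0
cost (node _ _ l r) = ℕ.suc (cost l ℕ.⊔ cost r)

-- c <D[ ℳ ] P says that D^ℳ(P) exceeds c.  D^ℳ(P) is a minimum of a set of
-- costs (∞ if the set is empty), so it exceeds c iff every member does.  The
-- minimum is not defined as a number because it is not computable for an
-- arbitrary ℳ.
_<D[_]_ : ℕ → MatrixSet ℓ → Matrix N N → Set ℓ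
c <D[ ℳ ] P = (π : Protocol ℳ _) → Computes π P → c < cost π

D[_]_⟶∞ : MatrixSet ℓ → {size : ℕ → ℕ} → ((n : ℕ) → Matrix (size n) (size n)) → Set ℓ
D[ ℳ ] P ⟶∞ = ∀ c → ∃[ n₀ ] (∀ n → n₀ ≤ n → c <D[ ℳ ] P n)

{-# OPTIONS --safe #-}

-- Ramsey's theorem makes the oracle matrices canonical.  Rows and columns are
-- first restricted to vectors built from m zones of two coordinates: a row has
-- exactly one 1 in every zone, in the second coordinate if the zone is altered
-- and in the first otherwise; a column is 0 on its empty zones and has the 1
-- first elsewhere.  Ramsey for the coordinates makes every query depend only on
-- the empty zones J and on the set of nonempty zones that are altered, while
-- the Hamming distance is |J| plus twice the number of those zones.  Ramsey for
-- the zones makes the queries depend only on the order type of the pair (S , J)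
-- of altered and empty zones.  Let |J| = k.  By stability, the value at S = {i}
-- with i outside J does not depend on the position of i relative to J, for
-- otherwise letting i and one element of J vary yields a large GT.  If this
-- value differs from the one at S = ∅, then the k + 1 columns K ∖ {i}, i ∈ K,
-- of a (k + 1)-set K are shattered by the rows S ⊆ K, against the VC dimension.
-- Hence no query, and so no protocol, separates the distances k and k + 2.
module Submission where

open import Defs
open import Data.Bool using (Bool; true; false; not; _∧_; if_then_else_; _xor_)
open import Data.Bool.Properties using (if-not) renaming (_≟_ to _≟ᵇ_)
open import Data.Empty using (⊥-elim)
open import Data.Fin as Fin using (Fin; zero; suc; toℕ; finToFun; funToFin; _↑ˡ_; _↑ʳ_)
open import Data.Fin.Permutation using (_⟨$⟩ʳ_)
open import Data.Fin.Properties using (finToFun-funToFin; injective⇒≤; toℕ-↑ˡ; toℕ<n)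
  renaming (_≟_ to _≟ᶠ_)
open import Data.Fin.Subset using (Subset; ⁅_⁆; ⊥; ∁)
open import Data.Fin.Subset.Properties using (x∈⁅x⁆; x∈⁅y⁆⇒x≡y)
open import Data.List as List
  using (List; []; _∷_; _++_; length; replicate; cartesianProductWith)
open import Data.List.Membership.Propositional using (_∈_)
open import Data.List.Membership.Propositional.Properties
  using (∈-cartesianProductWith⁺; ∈-++⁺ˡ; ∈-++⁺ʳ)
open import Data.List.Properties using (length-map; length-++)
open import Data.List.Relation.Unary.All as All using (All; []; _∷_)
open import Data.List.Relation.Unary.All.Properties using (map⁻; ++⁺; ++⁻)
open import Data.List.Relation.Unary.Any using (here; there)
open import Data.Nat as ℕ
  using (ℕ; zero; suc; _+_; _*_; _∸_; _^_; _≤_; _<_; _≤?_; z≤n; s≤s; z<s)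
open import Data.Nat.Properties
  using (≤-refl; ≤-reflexive; ≤-trans; <⇒≤; ≰⇒>; 1+n≰n; n≤1+n; m≤m+n; m≤n+m; +-suc; m+1+n≢n;
         +-mono-≤; +-monoʳ-≤; ∸-monoʳ-<; m∸n≤m; m⊔n≤o⇒m≤o; m⊔n≤o⇒n≤o)
open import Data.Product using (_×_; _,_; proj₁; proj₂; ∃-syntax; Σ-syntax)
open import Data.Sum using (_⊎_; inj₁; inj₂; [_,_]′)
open import Data.Vec as Vec using (Vec; []; _∷_; lookup; tabulate; count; zipWith)
open import Data.Vec.Properties using (lookup-replicate; lookup-map; lookup⇒[]=; []=⇒lookup)
open import Function using (_∘_)
open import Function.Bundles using (_⇔_; mk⇔; Equivalence)
open import Level as Level using (Level)
open import Relation.Binary.Core using (_Preserves_⟶_)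
open import Relation.Binary.PropositionalEquality
  using (_≡_; refl; sym; trans; cong; cong₂; subst; subst₂; module ≡-Reasoning)
open import Relation.Nullary using (¬_; ¬?; yes; no; does; contradiction)
open import Relation.Nullary.Decidable using (dec-true; dec-false; decidable-stable)
open import Relation.Unary using (Pred; Decidable)

private
  variable
    ℓ : Level
    ℳ : MatrixSet ℓ
    a b d k l m m′ n n′ N p r s t : ℕ
    A : Matrix m n

-- Ramsey's theorem for thinnings

infix 4 _≼_
infixr 9 _∙_

-- A thinning m ≼ n is an m-element subset of an n-element linear order.
data _≼_ : ℕ → ℕ → Set where
  done : 0 ≼ 0
  keep : m ≼ n → suc m ≼ suc n
  skip : m ≼ n → m ≼ suc n

_∙_ : m ≼ n → l ≼ m → l ≼ n
done   ∙ φ      = φ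
keep θ ∙ keep φ = keep (θ ∙ φ)
keep θ ∙ skip φ = skip (θ ∙ φ)
skip θ ∙ φ      = skip (θ ∙ φ)

∙-assoc : (θ : m ≼ n) (φ : l ≼ m) (ψ : k ≼ l) → (θ ∙ φ) ∙ ψ ≡ θ ∙ (φ ∙ ψ)
∙-assoc done     φ        ψ        = refl
∙-assoc (keep θ) (keep φ) (keep ψ) = cong keep (∙-assoc θ φ ψ)
∙-assoc (keep θ) (keep φ) (skip ψ) = cong skip (∙-assoc θ φ ψ)
∙-assoc (keep θ) (skip φ) ψ        = cong skip (∙-assoc θ φ ψ)
∙-assoc (skip θ) φ        ψ        = cong skip (∙-assoc θ φ ψ)

none : ∀ n → 0 ≼ n
none zero    = done
none (suc n) = skip (none n)

none-unique : (φ : 0 ≼ n) → φ ≡ none n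
none-unique done     = refl
none-unique (skip φ) = cong skip (none-unique φ)

≤⇒≼ : m ≤ n → m ≼ n
≤⇒≼ {n = n} z≤n = none n
≤⇒≼ (s≤s m≤n)   = keep (≤⇒≼ m≤n)

≼-refl : n ≼ n
≼-refl {zero}  = done
≼-refl {suc n} = keep ≼-refl

first : ∀ m n → m ≼ m + n
first zero    n = none n
first (suc m) n = keep (first m n)

last : ∀ m n → n ≼ m + n
last zero    n = ≼-refl
last (suc m) n = skip (last m n)

Colouring : ℕ → ℕ → Set
Colouring r n = r ≼ n → Bool

Monochromatic : Bool → Colouring r n → s ≼ n → Set
Monochromatic {r} {s = s} b χ θ = (φ : r ≼ s) → χ (θ ∙ φ) ≡ b

ramseyNumber : (r s t : ℕ) → ℕ
ramseyNumber zero    s       t       = s + t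
ramseyNumber (suc r) zero    t       = 0
ramseyNumber (suc r) (suc s) zero    = 0
ramseyNumber (suc r) (suc s) (suc t) =
  suc (ramseyNumber r (ramseyNumber (suc r) s (suc t)) (ramseyNumber (suc r) (suc s) t))

-- The partition relation n → (s , t)ʳ.
Arrow : (n r s t : ℕ) → Set
Arrow n r s t = (χ : Colouring r n) →
  (Σ[ θ ∈ s ≼ n ] Monochromatic true χ θ) ⊎ (Σ[ θ ∈ t ≼ n ] Monochromatic false χ θ)

private
  cons : ∀ {c} (χ : Colouring (suc r) (suc n)) (η : p ≼ n) (θ : s ≼ p) →
    Monochromatic c (λ φ → χ (keep φ)) η → Monochromatic c (λ φ → χ (skip (η ∙ φ))) θ →
    Monochromatic c χ (keep (η ∙ θ))
  cons χ η θ mη mθ (keep φ) = trans (cong (λ ψ → χ (keep ψ)) (∙-assoc η θ φ)) (mη (θ ∙ φ))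
  cons χ η θ mη mθ (skip φ) = trans (cong (λ ψ → χ (skip ψ)) (∙-assoc η θ φ)) (mθ φ)

  drop : ∀ {c} (χ : Colouring (suc r) (suc n)) (η : p ≼ n) (θ : s ≼ p) →
    Monochromatic c (λ φ → χ (skip (η ∙ φ))) θ → Monochromatic c χ (skip (η ∙ θ))
  drop χ η θ mθ φ = trans (cong (λ ψ → χ (skip ψ)) (∙-assoc η θ φ)) (mθ φ)

-- Colour an `r`-set of later points as that set with the first point added. Inside a set
-- monochromatic for this link colouring, a set of the same colour can be extended by the first
-- point, and one of the other colour is already large enough.
arrow-suc : Arrow n r a b → Arrow a (suc r) s (suc t) → Arrow b (suc r) (suc s) t →
  Arrow (suc n) (suc r) (suc s) (suc t)
arrow-suc link f g χ with link (λ φ → χ (keep φ))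
... | inj₁ (η , mη) with f (λ φ → χ (skip (η ∙ φ)))
...   | inj₁ (θ , mθ) = inj₁ (keep (η ∙ θ) , cons χ η θ mη mθ)
...   | inj₂ (θ , mθ) = inj₂ (skip (η ∙ θ) , drop χ η θ mθ)
arrow-suc link f g χ | inj₂ (η , mη) with g (λ φ → χ (skip (η ∙ φ)))
...   | inj₁ (θ , mθ) = inj₁ (skip (η ∙ θ) , drop χ η θ mθ)
...   | inj₂ (θ , mθ) = inj₂ (keep (η ∙ θ) , cons χ η θ mη mθ)

ramsey : ∀ r s t → Arrow (ramseyNumber r s t) r s t
ramsey zero s t χ with χ (none (s + t)) in eq
... | true  = inj₁ (first s t , λ φ → trans (cong χ (none-unique _)) eq)
... | false = inj₂ (last s t , λ φ → trans (cong χ (none-unique _)) eq)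
ramsey (suc r) zero    t       χ = inj₁ (done , λ ())
ramsey (suc r) (suc s) zero    χ = inj₂ (done , λ ())
ramsey (suc r) (suc s) (suc t)   =
  arrow-suc (ramsey r _ _) (ramsey (suc r) s (suc t)) (ramsey (suc r) (suc s) t)

monochromatic : Arrow n r s s → (χ : Colouring r n) → ∃[ c ] Σ[ θ ∈ s ≼ n ] Monochromatic c χ θ
monochromatic arrow χ = [ (true ,_) , (false ,_) ]′ (arrow χ)

-- Order types of pairs of Boolean vectors

push : m ≼ n → Vec Bool m → Vec Bool n
push done     []      = []
push (keep θ) (b ∷ x) = b ∷ push θ x
push (skip θ) x       = false ∷ push θ x

push-∙ : (θ : m ≼ n) (φ : l ≼ m) (x : Vec Bool l) → push (θ ∙ φ) x ≡ push θ (push φ x)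
push-∙ done     done     []      = refl
push-∙ (keep θ) (keep φ) (b ∷ x) = cong (b ∷_) (push-∙ θ φ x)
push-∙ (keep θ) (skip φ) x       = cong (false ∷_) (push-∙ θ φ x)
push-∙ (skip θ) φ        x       = cong (false ∷_) (push-∙ θ φ x)

Word : Set
Word = List (Bool × Bool)

-- The order type of a pair: its nonzero positions in order.
word : Vec Bool n → Vec Bool n → Word
word []          []          = []
word (false ∷ x) (false ∷ y) = word x y
word (false ∷ x) (true  ∷ y) = (false , true) ∷ word x y
word (true  ∷ x) (c     ∷ y) = (true , c) ∷ word x y

word-push : (θ : m ≼ n) (x y : Vec Bool m) → word (push θ x) (push θ y) ≡ word x y
word-push done     []          []          = refl
word-push (keep θ) (false ∷ x) (false ∷ y) = word-push θ x y
word-push (keep θ) (false ∷ x) (true  ∷ y) = cong (_ ∷_) (word-push θ x y)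
word-push (keep θ) (true  ∷ x) (c     ∷ y) = cong (_ ∷_) (word-push θ x y)
word-push (skip θ) x           y           = word-push θ x y

left right : (w : Word) → Vec Bool (length w)
left  w = Vec.map proj₁ (Vec.fromList w)
right w = Vec.map proj₂ (Vec.fromList w)

support : (x y : Vec Bool n) → let w = word x y in
  Σ[ φ ∈ length w ≼ n ] (push φ (left w) ≡ x) × (push φ (right w) ≡ y)
support [] [] = done , refl , refl
support (false ∷ x) (false ∷ y) with φ , p , q ← support x y = skip φ , cong (_ ∷_) p , cong (_ ∷_) q
support (false ∷ x) (true  ∷ y) with φ , p , q ← support x y = keep φ , cong (_ ∷_) p , cong (_ ∷_) q
support (true  ∷ x) (c     ∷ y) with φ , p , q ← support x y = keep φ , cong (_ ∷_) p , cong (_ ∷_) q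

letters : Word
letters = (false , true) ∷ (true , false) ∷ (true , true) ∷ []

words : ℕ → List Word
words zero    = [] ∷ []
words (suc n) = words n ++ cartesianProductWith _∷_ letters (words n)

word∈words : (x y : Vec Bool n) → word x y ∈ words n
word∈words [] [] = here refl
word∈words (false ∷ x) (false ∷ y) = ∈-++⁺ˡ (word∈words x y)
word∈words {suc n} (false ∷ x) (true  ∷ y) =
  ∈-++⁺ʳ (words n) (∈-cartesianProductWith⁺ _∷_ {xs = letters} (here refl) (word∈words x y))
word∈words {suc n} (true  ∷ x) (false ∷ y) =
  ∈-++⁺ʳ (words n) (∈-cartesianProductWith⁺ _∷_ {xs = letters} (there (here refl)) (word∈words x y))
word∈words {suc n} (true  ∷ x) (true  ∷ y) =
  ∈-++⁺ʳ (words n) (∈-cartesianProductWith⁺ _∷_ {xs = letters} (there (there (here refl))) (word∈words x y))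

-- Order-invariant tables by iterated use of Ramsey's theorem

Table : ℕ → Set
Table n = Vec Bool n → Vec Bool n → Bool

restrict : m ≼ n → Table n → Table m
restrict θ F x y = F (push θ x) (push θ y)

OrderInvariant : Table n → Set
OrderInvariant F = ∀ x y x′ y′ → word x y ≡ word x′ y′ → F x y ≡ F x′ y′

orderInvariant-restrict : (θ : m ≼ n) (F : Table n) →
  OrderInvariant F → OrderInvariant (restrict θ F)
orderInvariant-restrict θ F inv x y x′ y′ eq =
  inv _ _ _ _ (trans (word-push θ x y) (trans eq (sym (word-push θ x′ y′))))

restrict-∙ : (θ : m ≼ n) (φ : l ≼ m) (F : Table n) (x y : Vec Bool l) →
  restrict (θ ∙ φ) F x y ≡ restrict φ (restrict θ F) x y
restrict-∙ θ φ F x y = cong₂ F (push-∙ θ φ x) (push-∙ θ φ y)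

orderInvariant-∙ : (θ : m ≼ n) (φ : l ≼ m) (F : Table n) →
  OrderInvariant (restrict φ (restrict θ F)) → OrderInvariant (restrict (θ ∙ φ) F)
orderInvariant-∙ θ φ F inv x y x′ y′ eq =
  trans (restrict-∙ θ φ F x y) (trans (inv x y x′ y′ eq) (sym (restrict-∙ θ φ F x′ y′)))

-- Pairs of order type `w` correspond to sets of `length w` positions, as `support` shows, so this
-- is the constancy of a colouring of such sets.
Respects : Word → Table n → Set
Respects {n} w F = ∃[ b ] ((φ : length w ≼ n) → restrict φ F (left w) (right w) ≡ b)

respects-∙ : ∀ w (θ : m ≼ n) (φ : l ≼ m) (F : Table n) →
  Respects w (restrict θ F) → Respects w (restrict (θ ∙ φ) F)
respects-∙ w θ φ F (b , eq) = b , λ ψ →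
  trans (restrict-∙ θ φ F _ _)
    (trans (sym (restrict-∙ φ ψ (restrict θ F) (left w) (right w))) (eq (φ ∙ ψ)))

respects-∙ʳ : ∀ w (θ : m ≼ n) (φ : l ≼ m) (F : Table n) →
  Respects w (restrict φ (restrict θ F)) → Respects w (restrict (θ ∙ φ) F)
respects-∙ʳ w θ φ F (b , eq) = b , λ ψ → trans (restrict-∙ θ φ F _ _) (eq ψ)

respects⇒orderInvariant : (F : Table n) → All (λ w → Respects w F) (words n) → OrderInvariant F
respects⇒orderInvariant F respected x y x′ y′ eq with support x y | support x′ y′
... | φ , p , q | φ′ , p′ , q′ with b , const ← All.lookup respected (word∈words x y) = begin
  F x y                                         ≡⟨ cong₂ F p q ⟨
  restrict φ F (left (word x y)) (right (word x y)) ≡⟨ const φ ⟩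
  b                                             ≡⟨ lemma φ′ p′ q′ ⟩
  F x′ y′                                       ∎
  where
  open ≡-Reasoning
  lemma : (φ : length (word x′ y′) ≼ _) → push φ (left (word x′ y′)) ≡ x′ →
    push φ (right (word x′ y′)) ≡ y′ → b ≡ F x′ y′
  lemma φ p q rewrite sym eq = trans (sym (const φ)) (cong₂ F p q)

wordsNumber : List Word → ℕ → ℕ
wordsNumber []       s = s
wordsNumber (w ∷ ws) s = let t = wordsNumber ws s in ramseyNumber (length w) t t

-- One word is treated at a time: a word made constant on `η` stays constant on every thinning of
-- `η`, so later rounds do no harm.
ramsey-words : ∀ ws s (F : Table (wordsNumber ws s)) →
  Σ[ θ ∈ s ≼ _ ] All (λ w → Respects w (restrict θ F)) ws
ramsey-words []       s F = ≼-refl , []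
ramsey-words (w ∷ ws) s F
  with c , η , mη ← monochromatic (ramsey (length w) _ _) (λ φ → restrict φ F (left w) (right w))
  with θ , respected ← ramsey-words ws s (restrict η F) =
  η ∙ θ , respects-∙ w η θ F (c , λ φ → trans (sym (restrict-∙ η φ F _ _)) (mη φ))
        ∷ All.map (λ {v} → respects-∙ʳ v η θ F) respected

-- Once a table has been thinned to `t` positions, only the order types in `words t` can occur in
-- it.
tablesNumber : (q s : ℕ) → ℕ
tablesNumber zero    s = s
tablesNumber (suc q) s = let t = tablesNumber q s in wordsNumber (words t) t

ramsey-tables : ∀ q s (Fs : List (Table (tablesNumber q s))) → length Fs ≤ q →
  Σ[ θ ∈ s ≼ _ ] All (λ F → OrderInvariant (restrict θ F)) Fs
ramsey-tables zero    s []       _         = ≼-refl , []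
ramsey-tables (suc q) s []       _         =
  let t = tablesNumber q s
      -- A shorter list still needs a thinning from the full size; a constant table supplies one.
      η , _ = ramsey-words (words t) t (λ _ _ → true)
      θ , _ = ramsey-tables q s [] z≤n
  in η ∙ θ , []
ramsey-tables (suc q) s (F ∷ Fs) (s≤s len)
  with η , respected ← ramsey-words (words (tablesNumber q s)) (tablesNumber q s) F
  with θ , invs ← ramsey-tables q s (List.map (restrict η) Fs)
                    (subst (_≤ q) (sym (length-map (restrict η) Fs)) len) =
  η ∙ θ , orderInvariant-∙ η θ F
            (orderInvariant-restrict θ (restrict η F)
              (respects⇒orderInvariant (restrict η F) respected))
        ∷ All.map (λ {G} → orderInvariant-∙ η θ G) (map⁻ invs)

-- Query sets, shattering and protocols

prepend : (f : Fin m′ → Fin m) → Fin (m′ + m) → Fin m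
prepend {zero}   f i       = i
prepend {suc m′} f zero    = f zero
prepend {suc m′} f (suc i) = prepend (f ∘ suc) i

prepend-↑ˡ : (f : Fin m′ → Fin m) (i : Fin m′) → prepend f (i ↑ˡ m) ≡ f i
prepend-↑ˡ f zero    = refl
prepend-↑ˡ f (suc i) = prepend-↑ˡ (f ∘ suc) i

prepend-↑ʳ : (f : Fin m′ → Fin m) (i : Fin m) → prepend f (m′ ↑ʳ i) ≡ i
prepend-↑ʳ {zero}   f i = refl
prepend-↑ʳ {suc m′} f i = prepend-↑ʳ (f ∘ suc) i

↑ˡ-mono-< : ∀ n → (_↑ˡ n) Preserves (Fin._<_ {m} {m}) ⟶ Fin._<_
↑ˡ-mono-< n {i} {j} = subst₂ _<_ (sym (toℕ-↑ˡ i n)) (sym (toℕ-↑ˡ j n))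

-- A map that repeats or reorders rows is realised by duplicating the rows `f i` one after another
-- in front of the matrix and keeping only these copies.
selectRows : (f : Fin m′ → Fin m) → QS ℳ A → QS ℳ (λ i j → A (f i) j)
selectRows {m = m} {ℳ = ℳ} {A = A} f q =
  resp (λ i j → cong (λ r → A r j) (prepend-↑ˡ f i))
    (sub (_↑ˡ m) (λ j → j) (↑ˡ-mono-< m) (λ j<j′ → j<j′) (duplicates f))
  where
  duplicates : (f : Fin m′ → Fin m) → QS ℳ (λ i j → A (prepend f i) j)
  duplicates {zero}   f = q
  duplicates {suc m′} f = resp
    (λ { zero    j → cong (λ r → A r j) (prepend-↑ʳ (f ∘ suc) (f zero))
       ; (suc i) j → refl })
    (dupRow (m′ ↑ʳ f zero) (duplicates (f ∘ suc)))

selectColumns : (g : Fin n′ → Fin n) → QS ℳ A → QS ℳ (λ i j → A i (g j))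
selectColumns {n = n} {ℳ = ℳ} {A = A} g q =
  resp (λ i j → cong (A i) (prepend-↑ˡ g j))
    (sub (λ i → i) (_↑ˡ n) (λ i<i′ → i<i′) (↑ˡ-mono-< n) (duplicates g))
  where
  duplicates : (g : Fin n′ → Fin n) → QS ℳ (λ i j → A i (prepend g j))
  duplicates {zero}   g = q
  duplicates {suc n′} g = resp
    (λ { i zero    → cong (A i) (prepend-↑ʳ (g ∘ suc) (g zero))
       ; i (suc j) → refl })
    (dupCol (n′ ↑ʳ g zero) (duplicates (g ∘ suc)))

shatters-select : (A : Matrix m n) (f : Fin m′ → Fin m) (g : Fin n′ → Fin n) →
  Shatters (λ i j → A (f i) (g j)) d → Shatters A d
shatters-select A f g (y , rows) = g ∘ y , λ S → let x , hit = rows S in f x , hit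

shatters-resp : {A B : Matrix m n} → (∀ i j → A i j ≡ B i j) → Shatters B d → Shatters A d
shatters-resp eq (y , rows) = y , λ S →
  let x , hit = rows S in x , λ i → subst (λ b → (b ≡ true) ⇔ _) (sym (eq x (y i))) (hit i)

-- Every operation reads the entries of the old matrix along maps of rows and columns, and a
-- shattering can be carried along such maps.
shatters-base : QS ℳ A → Shatters A d → ∃[ m ] ∃[ n ] Σ[ M ∈ Matrix m n ] (ℳ m n M × Shatters M d)
shatters-base (base M∈)       sh = _ , _ , _ , M∈ , sh
shatters-base (resp eq q)     sh = shatters-base q (shatters-resp eq sh)
shatters-base (permute {A = A} σ τ q) sh = shatters-base q (shatters-select A (σ ⟨$⟩ʳ_) (τ ⟨$⟩ʳ_) sh)
shatters-base (sub {A = A} f g _ _ q) sh = shatters-base q (shatters-select A f g sh)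
shatters-base (dupRow {A = A} r q)    sh = shatters-base q (shatters-select A (copy r) (λ j → j) sh)
shatters-base (dupCol {A = A} c q)    sh = shatters-base q (shatters-select A (λ i → i) (copy c) sh)

shatters⇒≤ : (A : Matrix m n) → Shatters A d → d ≤ n
shatters⇒≤ A (y , rows) = injective⇒≤ λ {i} {j} yi≡yj →
  let x , hit = rows ⁅ i ⁆
      open Equivalence
  in sym (x∈⁅y⁆⇒x≡y i (to (hit j) (trans (cong (A x) (sym yi≡yj)) (from (hit i) (x∈⁅x⁆ i)))))

-- The double negation spares a decision procedure for Shatters.
shatters⇒¬¬vcDim : (M : Matrix m n) → Shatters M d → ¬ ¬ (∃[ e ] (d ≤ e × HasVCDim M e))
shatters⇒¬¬vcDim {n = n} M sh none = climb n sh ≤-refl (m≤m+n n _)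
  where
  -- `fuel` bounds how often a larger shattered set can replace the current one: none has more than
  -- `n` columns.
  climb : ∀ fuel {e} → Shatters M e → _ ≤ e → n ≤ fuel + e → _
  climb fuel {e} sh d≤e n≤ = none (e , d≤e , sh , λ e′ sh′ → decidable-stable (e′ ≤? e) (bigger fuel n≤ sh′))
    where
    bigger : ∀ fuel → n ≤ fuel + e → ∀ {e′} → Shatters M e′ → ¬ ¬ (e′ ≤ e)
    bigger zero       n≤ sh′ e′≰e = e′≰e (≤-trans (shatters⇒≤ M sh′) n≤)
    bigger (suc fuel) n≤ sh′ e′≰e = climb fuel sh′ (≤-trans d≤e (<⇒≤ (≰⇒> e′≰e)))
      (≤-trans n≤ (≤-trans (≤-reflexive (sym (+-suc fuel e))) (+-monoʳ-≤ fuel (≰⇒> e′≰e))))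

shatters⇒≤vcDim : ∀ {k} → SetHasVCDim ℳ d → QS ℳ A → Shatters A k → k ≤ d
shatters⇒≤vcDim {d = d} {k = k} (_ , bounded) q sh = decidable-stable (k ≤? d) λ k≰d →
  let m , n , M , M∈ , shM = shatters-base q sh in
  shatters⇒¬¬vcDim M shM λ { (e , k≤e , vc) → k≰d (≤-trans k≤e (bounded m n M M∈ e vc)) }

-- Queries of a protocol

queries : Protocol ℳ N → List (Matrix N N)
queries (leaf _)       = []
queries (node A _ l r) = A ∷ queries l ++ queries r

queries∈QS : (π : Protocol ℳ N) → All (QS ℳ) (queries π)
queries∈QS (leaf _)       = []
queries∈QS (node _ q l r) = q ∷ ++⁺ (queries∈QS l) (queries∈QS r)

-- This is 2^c - 1, the number of inner nodes of a complete binary tree of depth `c`.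
queryBound : ℕ → ℕ
queryBound zero    = 0
queryBound (suc c) = suc (queryBound c + queryBound c)

length-queries : ∀ c (π : Protocol ℳ N) → cost π ≤ c → length (queries π) ≤ queryBound c
length-queries c       (leaf _)       _         = z≤n
length-queries (suc c) (node _ _ l r) (s≤s le) = s≤s
  (subst (_≤ queryBound c + queryBound c) (sym (length-++ (queries l)))
    (+-mono-≤ (length-queries c l (m⊔n≤o⇒m≤o (cost l) (cost r) le))
              (length-queries c r (m⊔n≤o⇒n≤o (cost l) (cost r) le))))

output-cong : (π : Protocol ℳ N) {x x′ y y′ : Fin N} →
  All (λ A → A x y ≡ A x′ y′) (queries π) → output π x y ≡ output π x′ y′
output-cong (leaf _)       _ = refl
output-cong (node A _ l r) {x} {x′} {y} {y′} (eq ∷ eqs) with A x y | A x′ y′ | eq | ++⁻ (queries l) eqs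
... | true  | _ | refl | _ , eqsʳ = output-cong r eqsʳ
... | false | _ | refl | eqsˡ , _ = output-cong l eqsˡ

-- Hamming distance read off the order type

weight : Word → ℕ
weight []            = 0
weight ((a , b) ∷ w) = if a xor b then suc (weight w) else weight w

count-tabulate : ∀ {P : Pred (Fin m) Level.zero} (P? : Decidable P) (f : Fin n → Fin m) (u v : Vec Bool n) →
  (∀ i → does (P? (f i)) ≡ (lookup u i xor lookup v i)) →
  count P? (tabulate f) ≡ weight (word u v)
count-tabulate P? f []      []      eq = refl
count-tabulate P? f (a ∷ u) (b ∷ v) eq
  with does (P? (f zero)) | eq zero | count-tabulate P? (f ∘ suc) u v (eq ∘ suc)
count-tabulate P? f (false ∷ u) (false ∷ v) eq | _ | refl | ih = ih
count-tabulate P? f (false ∷ u) (true  ∷ v) eq | _ | refl | ih = cong suc ih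
count-tabulate P? f (true  ∷ u) (false ∷ v) eq | _ | refl | ih = cong suc ih
count-tabulate P? f (true  ∷ u) (true  ∷ v) eq | _ | refl | ih = ih

bit : Bool → Fin 2
bit false = zero
bit true  = suc zero

does-bit : ∀ a b → does (¬? (bit a ≟ᶠ bit b)) ≡ (a xor b)
does-bit false false = refl
does-bit false true  = refl
does-bit true  false = refl
does-bit true  true  = refl

index : Vec Bool n → Fin (2 ^ n)
index u = funToFin (bit ∘ lookup u)

hammingDistance-index : (u v : Vec Bool n) →
  hammingDistance (finToFun {2} {n} (index u)) (finToFun {2} {n} (index v)) ≡ weight (word u v)
hammingDistance-index {n} u v =
  count-tabulate (λ i → ¬? (finToFun (index u) i ≟ᶠ finToFun (index v) i)) (λ i → i) u v λ i →
    trans (cong₂ (λ a b → does (¬? (a ≟ᶠ b)))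
            (finToFun-funToFin (bit ∘ lookup u) i) (finToFun-funToFin (bit ∘ lookup v) i))
      (does-bit (lookup u i) (lookup v i))

-- Zones

word-++ : (x y : Vec Bool m) (x′ y′ : Vec Bool n) →
  word (x Vec.++ x′) (y Vec.++ y′) ≡ word x y ++ word x′ y′
word-++ []          []          x′ y′ = refl
word-++ (false ∷ x) (false ∷ y) x′ y′ = word-++ x y x′ y′
word-++ (false ∷ x) (true  ∷ y) x′ y′ = cong (_ ∷_) (word-++ x y x′ y′)
word-++ (true  ∷ x) (c     ∷ y) x′ y′ = cong (_ ∷_) (word-++ x y x′ y′)

-- S is the set of altered zones of a row, J the set of empty zones of a column.
rowCode : Vec Bool m → Vec Bool (m * 2)
rowCode []          = []
rowCode (false ∷ S) = true ∷ false ∷ rowCode S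
rowCode (true  ∷ S) = false ∷ true ∷ rowCode S

columnCode : Vec Bool m → Vec Bool (m * 2)
columnCode []          = []
columnCode (false ∷ J) = true ∷ false ∷ columnCode J
columnCode (true  ∷ J) = false ∷ false ∷ columnCode J

mask : Vec Bool n → Vec Bool n → Vec Bool n
mask = zipWith (λ j s → not j ∧ s)

mask-push : (θ : m ≼ n) (J S : Vec Bool m) → mask (push θ J) (push θ S) ≡ push θ (mask J S)
mask-push done     []      []      = refl
mask-push (keep θ) (j ∷ J) (s ∷ S) = cong (_ ∷_) (mask-push θ J S)
mask-push (skip θ) J       S       = cong (_ ∷_) (mask-push θ J S)

-- In an empty zone the column has no 1, so the single 1 of the row yields the same letter in either
-- coordinate. Altering shows only in nonempty zones, and `mask` keeps exactly these.
word-code : (J S S′ : Vec Bool m) → mask J S ≡ mask J S′ →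
  word (rowCode S) (columnCode J) ≡ word (rowCode S′) (columnCode J)
word-code []          []          []           eq = refl
word-code (true  ∷ J) (false ∷ S) (false ∷ S′) eq = cong (_ ∷_) (word-code J S S′ (cong Vec.tail eq))
word-code (true  ∷ J) (false ∷ S) (true  ∷ S′) eq = cong (_ ∷_) (word-code J S S′ (cong Vec.tail eq))
word-code (true  ∷ J) (true  ∷ S) (false ∷ S′) eq = cong (_ ∷_) (word-code J S S′ (cong Vec.tail eq))
word-code (true  ∷ J) (true  ∷ S) (true  ∷ S′) eq = cong (_ ∷_) (word-code J S S′ (cong Vec.tail eq))
word-code (false ∷ J) (s ∷ S)     (s′ ∷ S′)    eq with cong Vec.head eq
word-code (false ∷ J) (false ∷ S) (_ ∷ S′)     eq | refl = cong (_ ∷_) (word-code J S S′ (cong Vec.tail eq))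
word-code (false ∷ J) (true  ∷ S) (_ ∷ S′)     eq | refl = cong (λ w → _ ∷ _ ∷ w) (word-code J S S′ (cong Vec.tail eq))

-- The Hamming distance of the coded row and column.  The value at (false , false)
-- is junk: word does not produce this letter.
distance : Word → ℕ
distance []                  = 0
distance ((_     , true)  ∷ w) = suc (distance w)
distance ((true  , false) ∷ w) = suc (suc (distance w))
distance ((false , false) ∷ w) = distance w

weight-code : (S J : Vec Bool m) → weight (word (rowCode S) (columnCode J)) ≡ distance (word S J)
weight-code []          []          = refl
weight-code (false ∷ S) (false ∷ J) = weight-code S J
weight-code (false ∷ S) (true  ∷ J) = cong suc (weight-code S J)
weight-code (true  ∷ S) (false ∷ J) = cong (2 +_) (weight-code S J)
weight-code (true  ∷ S) (true  ∷ J) = cong suc (weight-code S J)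

emptied : ℕ → Word
emptied a = replicate a (false , true)

-- The order type of `({i}, J)` with `i` outside `J`, where `a` elements of `J` precede `i` and `b`
-- follow it.
altered : ℕ → ℕ → Word
altered a b = emptied a ++ (true , false) ∷ emptied b

emptied-∷ : ∀ a w → emptied a ++ (false , true) ∷ w ≡ emptied (suc a) ++ w
emptied-∷ zero    w = refl
emptied-∷ (suc a) w = cong (_ ∷_) (emptied-∷ a w)

prefix : ∀ n → ℕ → Vec Bool n
prefix zero    _       = []
prefix (suc n) zero    = false ∷ prefix n zero
prefix (suc n) (suc a) = true ∷ prefix n a

word-⊥-prefix : a ≤ n → word ⊥ (prefix n a) ≡ emptied a
word-⊥-prefix {n = zero}  z≤n       = refl
word-⊥-prefix {n = suc n} z≤n       = word-⊥-prefix {n = n} z≤n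
word-⊥-prefix             (s≤s a≤n) = cong (_ ∷_) (word-⊥-prefix a≤n)

unit : ∀ n → ℕ → Vec Bool n
unit zero    _       = []
unit (suc n) zero    = true ∷ ⊥
unit (suc n) (suc p) = false ∷ unit n p

word-⊥-⊥ : ∀ n → word (⊥ {n}) ⊥ ≡ []
word-⊥-⊥ zero    = refl
word-⊥-⊥ (suc n) = word-⊥-⊥ n

word-⊥-unit : ∀ n p → p < n → word ⊥ (unit n p) ≡ (false , true) ∷ []
word-⊥-unit (suc n) zero    _         = cong (_ ∷_) (word-⊥-⊥ n)
word-⊥-unit (suc n) (suc p) (s≤s p<n) = word-⊥-unit n p p<n

word-unit-⊥ : ∀ n p → p < n → word (unit n p) ⊥ ≡ (true , false) ∷ []
word-unit-⊥ (suc n) zero    _         = cong (_ ∷_) (word-⊥-⊥ n)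
word-unit-⊥ (suc n) (suc p) (s≤s p<n) = word-unit-⊥ n p p<n

word-unit-< : ∀ n p p′ → p < p′ → p′ < n →
  word (unit n p) (unit n p′) ≡ (true , false) ∷ (false , true) ∷ []
word-unit-< (suc n) zero    (suc p′) _          (s≤s p′<n) = cong (_ ∷_) (word-⊥-unit n p′ p′<n)
word-unit-< (suc n) (suc p) (suc p′) (s≤s p<p′) (s≤s p′<n) = word-unit-< n p p′ p<p′ p′<n

word-unit-> : ∀ n p p′ → p′ < p → p < n →
  word (unit n p) (unit n p′) ≡ (false , true) ∷ (true , false) ∷ []
word-unit-> (suc n) (suc p) zero     _          (s≤s p<n) = cong (_ ∷_) (word-unit-⊥ n p p<n)
word-unit-> (suc n) (suc p) (suc p′) (s≤s p′<p) (s≤s p<n) = word-unit-> n p p′ p′<p p<n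

word-⊥-∁⊥ : ∀ n → word ⊥ (∁ (⊥ {n})) ≡ emptied n
word-⊥-∁⊥ zero    = refl
word-⊥-∁⊥ (suc n) = cong (_ ∷_) (word-⊥-∁⊥ n)

word-⊥-∁⁅⁆ : (i : Fin (suc k)) → word ⊥ (∁ ⁅ i ⁆) ≡ emptied k
word-⊥-∁⁅⁆ {k}     zero    = word-⊥-∁⊥ k
word-⊥-∁⁅⁆ {suc k} (suc i) = cong (_ ∷_) (word-⊥-∁⁅⁆ i)

word-⁅⁆-∁⁅⁆ : (i : Fin (suc k)) → ∃[ a ] ∃[ b ] (a + b ≡ k × word ⁅ i ⁆ (∁ ⁅ i ⁆) ≡ altered a b)
word-⁅⁆-∁⁅⁆ {k}     zero    = 0 , k , refl , cong (_ ∷_) (word-⊥-∁⊥ k)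
word-⁅⁆-∁⁅⁆ {suc k} (suc i) with a , b , sum , eq ← word-⁅⁆-∁⁅⁆ i =
  suc a , b , cong suc sum , cong (_ ∷_) eq

distance-⊥-∁⊥ : ∀ n → distance (word ⊥ (∁ (⊥ {n}))) ≡ n
distance-⊥-∁⊥ zero    = refl
distance-⊥-∁⊥ (suc n) = cong suc (distance-⊥-∁⊥ n)

mask-∁⊥ : (S S′ : Subset n) → mask (∁ ⊥) S ≡ mask (∁ ⊥) S′
mask-∁⊥ []      []        = refl
mask-∁⊥ (_ ∷ S) (_ ∷ S′) = cong (false ∷_) (mask-∁⊥ S S′)

mask-∁⁅⁆ : (i : Fin n) (S S′ : Subset n) → lookup S i ≡ lookup S′ i →
  mask (∁ ⁅ i ⁆) S ≡ mask (∁ ⁅ i ⁆) S′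
mask-∁⁅⁆ zero    (s ∷ S) (s′ ∷ S′) eq = cong₂ _∷_ eq (mask-∁⊥ S S′)
mask-∁⁅⁆ (suc i) (s ∷ S) (s′ ∷ S′) eq = cong (false ∷_) (mask-∁⁅⁆ i S S′ eq)

if-true-false : ∀ b → (if b then true else false) ≡ b
if-true-false false = refl
if-true-false true  = refl

-- Distinct Booleans are false and true in one of two orders; the reversed order calls for the
-- complement.
selector : ∀ {u v} → ¬ (u ≡ v) → (S : Subset n) →
  Σ[ S′ ∈ Subset n ] (∀ i → (if lookup S′ i then v else u) ≡ lookup S i)
selector {u = false} {false} u≢v S = contradiction refl u≢v
selector {u = true}  {true}  u≢v S = contradiction refl u≢v
selector {u = false} {true}  u≢v S = S , λ i → if-true-false (lookup S i)
selector {u = true}  {false} u≢v S = ∁ S , λ i → begin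
  (if lookup (∁ S) i then false else true)   ≡⟨ cong (if_then false else true) (lookup-map i not S) ⟩
  (if not (lookup S i) then false else true) ≡⟨ if-not (lookup S i) {x = false} {y = true} ⟩
  (if lookup S i then true else false)       ≡⟨ if-true-false (lookup S i) ⟩
  lookup S i                                 ∎
  where open ≡-Reasoning

-- Half graphs and stability

module _ {A : Matrix m n} (unstable : ¬ QS ℳ (GT t)) (q : QS ℳ A) where

  noHalfGraph : (f : Fin t → Fin m) (g : Fin t → Fin n) →
    (∀ i j → i Fin.≤ j → A (f i) (g j) ≡ true) → ¬ (∀ i j → j Fin.< i → A (f i) (g j) ≡ false)
  noHalfGraph f g below above = unstable (resp entry (selectRows f (selectColumns g q)))
    where
    entry : ∀ i j → A (f i) (g j) ≡ GT t i j
    entry i j with toℕ i ℕ.≤? toℕ j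
    ... | yes i≤j = trans (below i j i≤j) (sym (dec-true (i Fin.≤? j) i≤j))
    ... | no  i≰j = trans (above i j (≰⇒> i≰j)) (sym (dec-false (i Fin.≤? j) i≰j))

  -- If the values differ, rows at the even positions 2i and columns at the odd positions 2j + 1
  -- give a forbidden half graph, because 2i < 2j + 1 exactly if i ≤ j.
  stable⇒symmetric : (r : ℕ → Fin m) (c : ℕ → Fin n) (u v : Bool) →
    (∀ p p′ → p < p′ → p′ ≤ suc (t + t) → A (r p) (c p′) ≡ u) →
    (∀ p p′ → p′ < p → p ≤ suc (t + t) → A (r p) (c p′) ≡ v) → u ≡ v
  stable⇒symmetric r c = go
    where
    T = suc (t + t)

    f g : Fin t → ℕ
    f i = toℕ i + toℕ i
    g i = suc (f i)

    f<g : ∀ {i j} → i Fin.≤ j → f i < g j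
    f<g i≤j = s≤s (+-mono-≤ i≤j i≤j)

    g<f : ∀ {i j} → j Fin.< i → g j < f i
    g<f {i} {j} j<i = subst (_≤ f i) (cong suc (+-suc (toℕ j) (toℕ j))) (+-mono-≤ j<i j<i)

    g≤T : ∀ i → g i ≤ T
    g≤T i = s≤s (+-mono-≤ (<⇒≤ (toℕ<n i)) (<⇒≤ (toℕ<n i)))

    f≤T : ∀ i → f i ≤ T
    f≤T i = ≤-trans (n≤1+n (f i)) (g≤T i)

    go : ∀ u v →
      (∀ p p′ → p < p′ → p′ ≤ T → A (r p) (c p′) ≡ u) →
      (∀ p p′ → p′ < p → p ≤ T → A (r p) (c p′) ≡ v) → u ≡ v
    go true  true  _     _     = refl
    go false false _     _     = refl
    go true  false below above = ⊥-elim (noHalfGraph (r ∘ f) (c ∘ g)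
      (λ i j i≤j → below _ _ (f<g i≤j) (g≤T j))
      (λ i j j<i → above _ _ (g<f j<i) (f≤T i)))
    -- With the two values interchanged, reflecting all positions in `T` exchanges before and after.
    go false true  below above = ⊥-elim (noHalfGraph (λ i → r (T ∸ f i)) (λ j → c (T ∸ g j))
      (λ i j i≤j → above _ _ (∸-monoʳ-< (f<g i≤j) (g≤T j)) (m∸n≤m T (f i)))
      (λ i j j<i → below _ _ (∸-monoʳ-< (g<f j<i) (f≤T i)) (m∸n≤m T (g j))))

-- One query on canonical rows and columns

MaskInvariant : Table n → Set
MaskInvariant F = ∀ J S S′ → mask J S ≡ mask J S′ → F S J ≡ F S′ J

-- The middle block has room for a half graph with t rows and t columns; the
-- blocks around it hold the fixed elements of J.
zones : (k t : ℕ) → ℕ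
zones k t = suc k + (suc (suc (t + t)) + suc k)

module Query {A : Matrix N N} (unstable : ¬ QS ℳ (GT t)) (q : QS ℳ A)
  (row column : Vec Bool (zones k t) → Fin N)
  (order-inv : OrderInvariant (λ S J → A (row S) (column J)))
  (mask-inv : MaskInvariant (λ S J → A (row S) (column J))) where

  G : Table (zones k t)
  G S J = A (row S) (column J)

  M : ℕ
  M = suc (suc (t + t))

  rowAt : ℕ → Vec Bool (zones k t)
  rowAt p = ⊥ {suc k} Vec.++ (unit M p Vec.++ ⊥ {suc k})

  -- One element of `J` moves in the middle block, while `a` fixed elements lie before that block
  -- and `b` after it, for `a` and `b` at most `k + 1`.
  columnAt : ℕ → ℕ → ℕ → Vec Bool (zones k t)
  columnAt a p b = prefix (suc k) a Vec.++ (unit M p Vec.++ prefix (suc k) b)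

  word-At : ∀ {a b} p p′ → a ≤ suc k → b ≤ suc k →
    word (rowAt p) (columnAt a p′ b) ≡ emptied a ++ (word (unit M p) (unit M p′) ++ emptied b)
  word-At {a} {b} p p′ a≤ b≤ =
    trans (word-++ ⊥ (prefix (suc k) a) _ _)
      (cong₂ _++_ (word-⊥-prefix a≤)
        (trans (word-++ (unit M p) (unit M p′) _ _)
          (cong (word (unit M p) (unit M p′) ++_) (word-⊥-prefix b≤))))

  word-At-< : ∀ {a b p p′} → a ≤ suc k → b ≤ suc k → p < p′ → p′ < M →
    word (rowAt p) (columnAt a p′ b) ≡ altered a (suc b)
  word-At-< {a} {b} {p} {p′} a≤ b≤ p<p′ p′<M = trans (word-At p p′ a≤ b≤)
    (cong (λ w → emptied a ++ (w ++ emptied b)) (word-unit-< M p p′ p<p′ p′<M))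

  word-At-> : ∀ {a b p p′} → a ≤ suc k → b ≤ suc k → p′ < p → p < M →
    word (rowAt p) (columnAt a p′ b) ≡ altered (suc a) b
  word-At-> {a} {b} {p} {p′} a≤ b≤ p′<p p<M = trans (word-At p p′ a≤ b≤)
    (trans (cong (λ w → emptied a ++ (w ++ emptied b)) (word-unit-> M p p′ p′<p p<M))
      (emptied-∷ a _))

  -- By order invariance the query sees only whether the altered zone lies before or after the
  -- moving element of `J`, as `stable⇒symmetric` requires.
  altered-swap : ∀ {a b} → a ≤ suc k → b ≤ suc k →
    G (rowAt 0) (columnAt a 1 b) ≡ G (rowAt 1) (columnAt a 0 b)
  altered-swap {a} {b} a≤ b≤ = stable⇒symmetric unstable q rowAt′ (λ p → column (columnAt a p b)) _ _
    (λ p p′ p<p′ p′≤ → order-inv _ _ _ _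
      (trans (word-At-< a≤ b≤ p<p′ (s≤s p′≤)) (sym (word-At-< a≤ b≤ z<s (s≤s z<s)))))
    (λ p p′ p′<p p≤ → order-inv _ _ _ _
      (trans (word-At-> a≤ b≤ p′<p (s≤s p≤)) (sym (word-At-> a≤ b≤ z<s (s≤s z<s)))))
    where
    rowAt′ : ℕ → Fin N
    rowAt′ p = row (rowAt p)

  -- Induction on `a`: each `altered-swap` carries the altered zone to the left across one element
  -- of `J`, until none precedes it.
  altered-const : ∀ a b → a + b ≡ k → ∀ {S J S′ J′} →
    word S J ≡ altered a b → word S′ J′ ≡ altered 0 k → G S J ≡ G S′ J′
  altered-const zero    b refl eq eq′ = order-inv _ _ _ _ (trans eq (sym eq′))
  altered-const (suc a) b sum {S} {J} {S′} {J′} eq eq′ = begin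
    G S J                         ≡⟨ order-inv _ _ _ _ (trans eq (sym (word-At-> a≤ b≤ z<s (s≤s z<s)))) ⟩
    G (rowAt 1) (columnAt a 0 b)  ≡⟨ altered-swap a≤ b≤ ⟨
    G (rowAt 0) (columnAt a 1 b)  ≡⟨ altered-const a (suc b) (trans (+-suc a b) sum)
                                       (word-At-< a≤ b≤ z<s (s≤s z<s)) eq′ ⟩
    G S′ J′                       ∎
    where
    open ≡-Reasoning
    a≤ : a ≤ suc k
    a≤ = ≤-trans (m≤m+n a (suc b)) (≤-trans (≤-reflexive (trans (+-suc a b) sum)) (n≤1+n k))
    b≤ : b ≤ suc k
    b≤ = ≤-trans (m≤n+m b (suc a)) (≤-trans (≤-reflexive sum) (n≤1+n k))

  -- The first `k + 1` zones serve as the set `K`; all later zones will be neither altered nor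
  -- empty.
  ι : suc k ≼ zones k t
  ι = first (suc k) (M + suc k)

  unaltered-value altered-value : Bool
  unaltered-value = G (push ι ⊥) (push ι (∁ ⁅ zero ⁆))
  altered-value   = G (push ι ⁅ zero ⁆) (push ι (∁ ⁅ zero ⁆))

  masked : (S : Subset (suc k)) (i : Fin (suc k)) (S′ : Subset (suc k)) → lookup S i ≡ lookup S′ i →
    G (push ι S) (push ι (∁ ⁅ i ⁆)) ≡ G (push ι S′) (push ι (∁ ⁅ i ⁆))
  masked S i S′ eq = mask-inv _ _ _ (trans (mask-push ι (∁ ⁅ i ⁆) S)
    (trans (cong (push ι) (mask-∁⁅⁆ i S S′ eq)) (sym (mask-push ι (∁ ⁅ i ⁆) S′))))

  -- Within `K` only zone `i` is nonempty, so `S` can be replaced by the empty set or by `{i}`,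
  -- according to its bit at `i`. Order invariance and `altered-const` then remove the dependence on
  -- the position of `i`.
  value : (S : Subset (suc k)) (i : Fin (suc k)) →
    G (push ι S) (push ι (∁ ⁅ i ⁆)) ≡ (if lookup S i then altered-value else unaltered-value)
  value S i with lookup S i in eq
  ... | false = trans (masked S i ⊥ (trans eq (sym (lookup-replicate i false))))
                  (order-inv _ _ _ _ (trans (word-push ι ⊥ (∁ ⁅ i ⁆)) (trans (word-⊥-∁⁅⁆ i)
                    (sym (trans (word-push ι ⊥ (∁ ⁅ zero ⁆)) (word-⊥-∁⁅⁆ {k} zero))))))
  ... | true  with a , b , sum , w≡ ← word-⁅⁆-∁⁅⁆ i =
    trans (masked S i ⁅ i ⁆ (trans eq (sym ([]=⇒lookup (x∈⁅x⁆ i)))))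
      (altered-const a b sum (trans (word-push ι ⁅ i ⁆ (∁ ⁅ i ⁆)) w≡)
        (trans (word-push ι ⁅ zero ⁆ (∁ ⁅ zero ⁆)) (cong (_ ∷_) (word-⊥-∁⊥ k))))

  distinguishes⇒shatters : ¬ (unaltered-value ≡ altered-value) → Shatters A (suc k)
  distinguishes⇒shatters differ = (λ i → column (push ι (∁ ⁅ i ⁆))) , λ S →
    let S′ , selects = selector differ S
        hit : ∀ i → G (push ι S′) (push ι (∁ ⁅ i ⁆)) ≡ lookup S i
        hit i = trans (value S′ i) (selects i)
    in row (push ι S′) , λ i →
      mk⇔ (λ eq → lookup⇒[]= i S (trans (sym (hit i)) eq))
          (λ i∈S → trans (hit i) ([]=⇒lookup i∈S))

-- Canonical rows and columns for all queries at once, and the lower bound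

record Selection (n L : ℕ) (As : List (Matrix (2 ^ n) (2 ^ n))) : Set where
  field
    row column      : Vec Bool L → Fin (2 ^ n)
    orderInvariants : All (λ A → OrderInvariant (λ S J → A (row S) (column J))) As
    maskInvariants  : All (λ A → MaskInvariant (λ S J → A (row S) (column J))) As
    distances       : ∀ S J → hammingDistance (finToFun {2} {n} (row S)) (finToFun {2} {n} (column J))
                                ≡ distance (word S J)

-- From the inside: the number of zones from which the second use of Ramsey keeps `L`, two
-- coordinates for each, and the number of coordinates from which the first use keeps these.
selectionNumber : (q L : ℕ) → ℕ
selectionNumber q L = tablesNumber q (tablesNumber q L * 2)

select : ∀ q L n (As : List (Matrix (2 ^ n) (2 ^ n))) →
  selectionNumber q L ≤ n → length As ≤ q → Selection n L As
select q L n As large short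
  with θ , inv ← ramsey-tables q (tablesNumber q L * 2)
         (List.map (λ A → restrict (≤⇒≼ large) (λ u v → A (index u) (index v))) As)
         (subst (_≤ q) (sym (length-map _ As)) short)
  with φ , inv′ ← ramsey-tables q L
         (List.map (λ A S J → A (index (push (≤⇒≼ large) (push θ (rowCode S))))
                                (index (push (≤⇒≼ large) (push θ (columnCode J))))) As)
         (subst (_≤ q) (sym (length-map _ As)) short) = record
  { row             = λ S → index (spread (rowCode (push φ S)))
  ; column          = λ J → index (spread (columnCode (push φ J)))
  ; orderInvariants = map⁻ inv′
  -- Rows with the same mask have codes of the same order type relative to the column, so order
  -- invariance over the coordinates identifies them.
  ; maskInvariants  = All.map
      (λ oi J S S′ eq → oi _ _ _ _ (word-code (push φ J) (push φ S) (push φ S′)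
        (trans (mask-push φ J S) (trans (cong (push φ) eq) (sym (mask-push φ J S′))))))
      (map⁻ inv)
  ; distances       = λ S J → let u = rowCode (push φ S); v = columnCode (push φ J) in begin
      hammingDistance (finToFun {2} {n} (index (spread u))) (finToFun {2} {n} (index (spread v)))
        ≡⟨ hammingDistance-index (spread u) (spread v) ⟩
      weight (word (spread u) (spread v))
        ≡⟨ cong weight (trans (word-push (≤⇒≼ large) _ _) (word-push θ u v)) ⟩
      weight (word u v)
        ≡⟨ weight-code (push φ S) (push φ J) ⟩
      distance (word (push φ S) (push φ J))
        ≡⟨ cong distance (word-push φ S J) ⟩
      distance (word S J) ∎
  }
  where
  open ≡-Reasoning
  spread : Vec Bool (tablesNumber q L * 2) → Vec Bool n
  spread u = push (≤⇒≼ large) (push θ u)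

theorem3p6 : ∀ {ℓ : Level} (𝒬 : MatrixSet ℓ) (d : ℕ) →
    Stable 𝒬 → SetHasVCDim 𝒬 d →
    ∀ (k : ℕ) → d ≤ k → D[ 𝒬 ] EHD k ⟶∞
theorem3p6 𝒬 d (t , unstable) vc k d≤k c =
  -- The threshold depends on `c`, `k` and `t` only, since a protocol of cost at most `c` has at
  -- most `queryBound c` queries.
  selectionNumber (queryBound c) (zones k t) , λ n large π computes → ≰⇒> λ cheap →
    let open Selection (select (queryBound c) (zones k t) n (queries π) large (length-queries c π cheap))
        ι        = first (suc k) (suc (suc (t + t)) + suc k)
        J        = push ι (∁ ⁅ zero ⁆)
        S        = push ι ⊥
        S′       = push ι ⁅ zero ⁆
        -- A query that differs on the two entries would shatter `k + 1` columns, which is more than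
        -- `d`.
        agreement : All (λ A → A (row S) (column J) ≡ A (row S′) (column J)) (queries π)
        agreement = All.zipWith
          (λ { {A} ((q , oi) , mi) → decidable-stable (_ ≟ᵇ _) λ differ →
               1+n≰n (≤-trans (shatters⇒≤vcDim vc q
                 (Query.distinguishes⇒shatters unstable q row column oi mi differ)) d≤k) })
          (All.zip (queries∈QS π , orderInvariants) , maskInvariants)
        entry : ∀ S J → EHD k n (row S) (column J) ≡ does (distance (word S J) ℕ.≟ k)
        entry S J = cong (λ h → does (h ℕ.≟ k)) (distances S J)
        near : distance (word S J) ≡ k
        near = trans (cong distance (word-push ι ⊥ (∁ ⁅ zero ⁆))) (distance-⊥-∁⊥ k)
        -- Altering zone 0, which is nonempty, makes both its coordinates differ and raises the
        -- distance by 2.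
        far : distance (word S′ J) ≡ 2 + k
        far = trans (cong distance (word-push ι ⁅ zero ⁆ (∁ ⁅ zero ⁆))) (cong (2 +_) (distance-⊥-∁⊥ k))
    in contradiction
         (begin
           true                             ≡⟨ dec-true (distance (word S J) ℕ.≟ k) near ⟨
           does (distance (word S J) ℕ.≟ k)   ≡⟨ entry S J ⟨
           EHD k n (row S) (column J)       ≡⟨ computes (row S) (column J) ⟨
           output π (row S) (column J)      ≡⟨ output-cong π agreement ⟩
           output π (row S′) (column J)     ≡⟨ computes (row S′) (column J) ⟩
           EHD k n (row S′) (column J)      ≡⟨ entry S′ J ⟩
           does (distance (word S′ J) ℕ.≟ k)  ≡⟨ dec-false (distance (word S′ J) ℕ.≟ k)
                                                  (λ eq → m+1+n≢n 1 (trans (sym far) eq)) ⟩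
           false                            ∎)
         (λ ())
  where
  open ≡-Reasoning
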